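{- Let $C_{(\geq,\neq)}(x,y)$ be the bivariate generating function of the Catalan words avoiding the ordered pair of relations $(\geq,\neq)$, where $x$ marks the length and $y$ marks the number of descents. Then $$C_{(\geq,\neq)}(x,y)=\frac {1-2x+2x^2-x^3+x^3y}{\left( 1-x \right) ^{3}}.$$
   Context: A Catalan word of length $n$ is a word $w=w_1w_2\cdots w_n$ over the non-negative integers with $w_1=0$ and $0\leq w_i\leq w_{i-1}+1$ for $i=2,\dots,n$; the empty word is the unique Catalan word of length $0$. For relations $X,Y\in\{<,>,\leq,\geq,=,\neq\}$, a word $w$ contains the pattern $(X,Y)$ if there is an index $i\geq 1$ (with $i+2\le n$) such that $w_i\,X\,w_{i+1}$ and $w_{i+1}\,Y\,w_{i+2}$; otherwise $w$ avoids $(X,Y)$. The number of descents $\mathrm{des}(w)$ is the number of indices $i$ with $w_i>w_{i+1}$. The bivariate generating function is $C_{(X,Y)}(x,y)=\sum_{w}x^{|w|}y^{\mathrm{des}(w)}$, the sum being over all Catalan words $w$ (of any length $|w|\geq 0$) avoiding $(X,Y)$. Identities are between formal power series in $x$ with coefficients polynomials in $y$. -}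

module Defs where

open import Algebra.Bundles.Raw using (RawRing)
import Algebra.Definitions.RawSemiring as RawSemiringDefinitions
open import Data.Bool.Base using (if_then_else_)
import Data.Integer.Base as ℤ
open import Data.List.Base
  using (List; []; _∷_; [_]; map; concatMap; foldr; filter; length; upTo; applyUpTo)
open import Data.List.Membership.Propositional using (_∈_)
open import Data.List.Membership.Propositional.Properties
  using (∈-map⁺; ∈-map⁻; ∈-concat⁺′; ∈-concat⁻′; ∈-upTo⁺; ∈-upTo⁻)
open import Data.List.Relation.Unary.All using ([]; _∷_)
import Data.List.Relation.Unary.All.Properties as All
open import Data.List.Relation.Unary.AllPairs using ([]; _∷_)
import Data.List.Relation.Unary.AllPairs as AllPairs
import Data.List.Relation.Unary.AllPairs.Properties as AllPairs
open import Data.List.Relation.Unary.Any using (here; there)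
open import Data.List.Relation.Unary.Linked using (Linked; []; [-]; _∷_)
open import Data.List.Relation.Unary.Unique.Propositional using (Unique)
import Data.List.Relation.Unary.Unique.Propositional.Properties as Unique
open import Data.List.Properties using (∷-injectiveˡ; ∷-injectiveʳ)
open import Data.Nat.Base using (ℕ; zero; suc; _∸_; _≤_; s≤s; s≤s⁻¹)
import Data.Nat.Base as ℕ
import Data.Nat.Properties as ℕ
open import Data.Product.Base using (_×_; _,_)
open import Data.Sum.Base using (inj₁; inj₂)
open import Level using (Level; 0ℓ)
open import Relation.Binary.Core using (Rel)
open import Relation.Binary.Definitions using (Decidable)
open import Relation.Binary.PropositionalEquality using (_≡_; _≢_; refl; cong)
open import Relation.Nullary.Decidable using (no; does; map′; _×-dec_; _⊎-dec_; ¬?)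
open import Relation.Nullary.Negation using (¬_)
import Relation.Unary as U

------------------------------------------------------------------------
-- Polynomials and formal power series

-- A polynomial is the list of its coefficients, constant term first.
-- Trailing zeros are allowed, so equality is coefficientwise.
module Polynomial {c ℓ : Level} (R : RawRing c ℓ) where
  open RawRing R

  coeff : List Carrier → ℕ → Carrier
  coeff []      k       = 0#
  coeff (a ∷ p) zero    = a
  coeff (a ∷ p) (suc k) = coeff p k

  add : List Carrier → List Carrier → List Carrier
  add []      q       = q
  add (a ∷ p) []      = a ∷ p
  add (a ∷ p) (b ∷ q) = a + b ∷ add p q

  mul : List Carrier → List Carrier → List Carrier
  mul []      q = []
  mul (a ∷ p) q = add (map (a *_) q) (0# ∷ mul p q)

  rawRing : RawRing c ℓ
  rawRing = record
    { Carrier = List Carrier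
    ; _≈_     = λ p q → ∀ k → coeff p k ≈ coeff q k
    ; _+_     = add
    ; _*_     = mul
    ; -_      = map -_
    ; 0#      = []
    ; 1#      = [ 1# ]
    }

  indeterminate : List Carrier
  indeterminate = 0# ∷ 1# ∷ []

-- A formal power series is the sequence of its coefficients.
module PowerSeries {c ℓ : Level} (R : RawRing c ℓ) where
  open RawRing R

  constant : Carrier → ℕ → Carrier
  constant a zero    = a
  constant a (suc n) = 0#

  indeterminate : ℕ → Carrier
  indeterminate zero          = 0#
  indeterminate (suc zero)    = 1#
  indeterminate (suc (suc n)) = 0#

  cauchyProduct : (ℕ → Carrier) → (ℕ → Carrier) → ℕ → Carrier
  cauchyProduct F G n = foldr _+_ 0# (applyUpTo (λ i → F i * G (n ∸ i)) (suc n))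

  rawRing : RawRing c ℓ
  rawRing = record
    { Carrier = ℕ → Carrier
    ; _≈_     = λ F G → ∀ n → F n ≈ G n
    ; _+_     = λ F G n → F n + G n
    ; _*_     = cauchyProduct
    ; -_      = λ F n → - F n
    ; 0#      = λ n → 0#
    ; 1#      = constant 1#
    }

ℤ[y] : RawRing 0ℓ 0ℓ
ℤ[y] = Polynomial.rawRing ℤ.+-*-rawRing

ℤ[y]⟦x⟧ : RawRing 0ℓ 0ℓ
ℤ[y]⟦x⟧ = PowerSeries.rawRing ℤ[y]

-- The operations of ℤ[y]⟦x⟧; `m × F` is the natural multiple m F.
module SeriesNotation where
  open RawRing ℤ[y]⟦x⟧ public
    using (Carrier; _≈_; _+_; _*_; -_; 0#; 1#; rawSemiring)
  open RawSemiringDefinitions rawSemiring public using (_^_; _×_)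

  infixl 6 _-_
  _-_ : Carrier → Carrier → Carrier
  F - G = F + (- G)

  x y : Carrier
  x = PowerSeries.indeterminate ℤ[y]
  y = PowerSeries.constant ℤ[y] (Polynomial.indeterminate ℤ.+-*-rawRing)

------------------------------------------------------------------------
-- Catalan words

Word : Set
Word = List ℕ

Step : Rel ℕ 0ℓ
Step a b = b ≤ suc a

data IsCatalan : Word → Set where
  []  : IsCatalan []
  0∷_ : ∀ {w} → Linked Step (0 ∷ w) → IsCatalan (0 ∷ w)

-- Occurrences are at consecutive positions: w_i X w_{i+1} and w_{i+1} Y w_{i+2}.
data Contains (X Y : Rel ℕ 0ℓ) : Word → Set where
  here  : ∀ {a b c w} → X a b → Y b c → Contains X Y (a ∷ b ∷ c ∷ w)
  there : ∀ {a w} → Contains X Y w → Contains X Y (a ∷ w)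

Avoids : (X Y : Rel ℕ 0ℓ) → Word → Set
Avoids X Y w = ¬ Contains X Y w

des : Word → ℕ
des []          = 0
des (a ∷ [])    = 0
des (a ∷ b ∷ w) = (if does (b ℕ.<? a) then 1 else 0) ℕ.+ des (b ∷ w)

module _ {X Y : Rel ℕ 0ℓ} (X? : Decidable X) (Y? : Decidable Y) where

  contains? : U.Decidable (Contains X Y)
  contains? []          = no λ ()
  contains? (a ∷ [])    = no λ { (there ()) }
  contains? (a ∷ b ∷ [])    = no λ { (there (there ())) }
  contains? (a ∷ b ∷ c ∷ w) =
    map′ (λ { (inj₁ (p , q)) → here p q ; (inj₂ r) → there r })
         (λ { (here p q) → inj₁ (p , q) ; (there r) → inj₂ r })
         ((X? a b ×-dec Y? b c) ⊎-dec contains? (b ∷ c ∷ w))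

  avoids? : U.Decidable (Avoids X Y)
  avoids? w = ¬? (contains? w)

-- `continuations a m` lists the words w of length m such that a ∷ w has all
-- steps admissible.
continuations : ℕ → ℕ → List Word
continuations a zero    = [ [] ]
continuations a (suc m) =
  concatMap (λ b → map (b ∷_) (continuations b m)) (upTo (suc (suc a)))

catalanWords : ℕ → List Word
catalanWords zero    = [ [] ]
catalanWords (suc m) = map (0 ∷_) (continuations 0 m)

-- `catalanWords n` lists each Catalan word of length n exactly once, so sums
-- over this list are sums over the set of those words.

continuations-sound : ∀ a m {w} → w ∈ continuations a m →
                      Linked Step (a ∷ w) × length w ≡ m
continuations-sound a zero    (here refl) = [-] , refl
continuations-sound a (suc m) w∈
  with ws , w∈ws , ws∈ ← ∈-concat⁻′ (map (λ b → map (b ∷_) (continuations b m)) (upTo (suc (suc a)))) w∈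
  with b , b∈ , refl ← ∈-map⁻ (λ b → map (b ∷_) (continuations b m)) ws∈
  with v , v∈ , refl ← ∈-map⁻ (b ∷_) w∈ws
  with linked , eq ← continuations-sound b m v∈
  = s≤s⁻¹ (∈-upTo⁻ b∈) ∷ linked , cong suc eq

continuations-complete : ∀ a w → Linked Step (a ∷ w) → w ∈ continuations a (length w)
continuations-complete a []      [-]           = here refl
continuations-complete a (b ∷ w) (b≤ ∷ linked) =
  ∈-concat⁺′ (∈-map⁺ (b ∷_) (continuations-complete b w linked))
             (∈-map⁺ (λ c → map (c ∷_) (continuations c (length w))) (∈-upTo⁺ (s≤s b≤)))

continuations-unique : ∀ a m → Unique (continuations a m)
continuations-unique a zero    = [] ∷ []
continuations-unique a (suc m) = Unique.concat⁺
  (All.map⁺ (All.applyUpTo⁺₂ (λ b → b) (suc (suc a))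
    (λ b → Unique.map⁺ ∷-injectiveʳ (continuations-unique b m))))
  (AllPairs.map⁺ (AllPairs.map disjoint (Unique.upTo⁺ (suc (suc a)))))
  where
  disjoint : ∀ {b c} → b ≢ c → ∀ {w} →
             ¬ (w ∈ map (b ∷_) (continuations b m) × w ∈ map (c ∷_) (continuations c m))
  disjoint {b} {c} b≢c (p , q)
    with _ , _ , refl ← ∈-map⁻ (b ∷_) p
    with _ , _ , eq ← ∈-map⁻ (c ∷_) q
    = b≢c (∷-injectiveˡ eq)

catalanWords-sound : ∀ n {w} → w ∈ catalanWords n → IsCatalan w × length w ≡ n
catalanWords-sound zero    (here refl) = [] , refl
catalanWords-sound (suc m) w∈
  with v , v∈ , refl ← ∈-map⁻ (0 ∷_) w∈
  with linked , eq ← continuations-sound 0 m v∈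
  = 0∷ linked , cong suc eq

catalanWords-complete : ∀ {w} → IsCatalan w → w ∈ catalanWords (length w)
catalanWords-complete []               = here refl
catalanWords-complete (0∷_ {w} linked) = ∈-map⁺ (0 ∷_) (continuations-complete 0 w linked)

catalanWords-unique : ∀ n → Unique (catalanWords n)
catalanWords-unique zero    = [] ∷ []
catalanWords-unique (suc m) = Unique.map⁺ ∷-injectiveʳ (continuations-unique 0 m)

------------------------------------------------------------------------
-- The generating function

-- The coefficient of xⁿ is the sum of y^{des w} over the Catalan words w of
-- length n avoiding (X , Y).
C : {X Y : Rel ℕ 0ℓ} → Decidable X → Decidable Y → RawRing.Carrier ℤ[y]⟦x⟧
C X? Y? n = foldr _+_ 0# (map (λ w → y ^ des w) (filter (avoids? X? Y?) (catalanWords n)))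
  where
  open RawRing ℤ[y]
  open RawSemiringDefinitions rawSemiring using (_^_)

  y : Carrier
  y = Polynomial.indeterminate ℤ.+-*-rawRing

_≢?_ : Decidable {A = ℕ} _≢_
a ≢? b = ¬? (a ℕ.≟ b)

{-# OPTIONS --safe #-}

-- After a weak descent w_i ≥ w_{i+1} an avoiding word must stay constant.  So a
-- Catalan word of length n ≥ 1 avoiding (≥ , ≠) is 0 1 ⋯ (n−1), or it is
-- 0 1 ⋯ (j−1) followed by a constant run of some b ≤ j−1 with 1 ≤ j ≤ n−1, which
-- has a descent exactly when b < j−1.  Hence the coefficient of xⁿ is
-- n + (n−1 choose 2) y.  For n ≥ 1 it is quadratic in n, so its third difference,
-- which is what (1 − x)³ extracts, vanishes; only the coefficients of
-- 1 , x , x² , x³ remain.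
module Submission where

open import Defs
open import Data.Nat.Properties using (_≥?_)
open SeriesNotation

open import Algebra.Bundles.Raw using (RawRing)
import Algebra.Definitions.RawSemiring as RawSemiringDefinitions
open import Data.Integer.Base using (ℤ; +_; -[1+_])
import Data.Integer.Base as ℤ
import Data.Integer.Properties as ℤ
open import Data.Integer.Tactic.RingSolver using (solve-∀)
open import Data.List.Base
  using (List; []; _∷_; [_]; _++_; map; concatMap; foldr; filter; replicate; upTo; applyUpTo; length)
open import Data.List.Membership.Propositional using (_∈_)
open import Data.List.Membership.Propositional.Properties using (∈-filter⁺; ∈-filter⁻; ∈-map⁺; ∈-map⁻)
open import Data.List.Properties
  using (map-++; filter-++; filter-accept; filter-reject; concatMap-++; upTo-∷ʳ; ∷-injectiveʳ
        ; ++-identityʳ; length-replicate)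
open import Data.List.Relation.Unary.All using (_∷_)
open import Data.List.Relation.Unary.AllPairs using (_∷_)
open import Data.List.Relation.Unary.Any using (here; there)
open import Data.List.Relation.Unary.Linked using (Linked; [-]; _∷_)
open import Data.List.Relation.Unary.Unique.Propositional using (Unique)
import Data.List.Relation.Unary.Unique.Propositional.Properties as Unique
open import Data.Nat.Base using (ℕ; zero; suc; _∸_; _≤_; _<_; z≤n; s≤s)
import Data.Nat.Base as ℕ
open import Data.Nat.Combinatorics using (nC1≡n; nCk+nC[k+1]≡[n+1]C[k+1])
  renaming (_C_ to _choose_)
import Data.Nat.Properties as ℕ
import Data.Nat.Tactic.RingSolver as ℕ-Solver
open import Data.Product.Base using (_,_; proj₂)
open import Function.Base using (_∘_)
open import Relation.Binary.PropositionalEquality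
  using (_≡_; _≢_; refl; sym; trans; cong; cong₂; subst; module ≡-Reasoning)
open import Relation.Nullary.Decidable using (yes; no; dec-true; dec-false)
open import Relation.Nullary.Negation using (¬_; contradiction)
open import Relation.Unary using (Decidable; Pred)

open ≡-Reasoning

private
  module Poly = RawRing ℤ[y]
  open Polynomial ℤ.+-*-rawRing using (coeff) renaming (indeterminate to yPoly)
  open RawSemiringDefinitions Poly.rawSemiring using () renaming (_^_ to _^ᵖ_)

-- Coefficients of polynomial sums and products

coeff-+ : ∀ p q k → coeff (p Poly.+ q) k ≡ coeff p k ℤ.+ coeff q k
coeff-+ []      q       k       = sym (ℤ.+-identityˡ _)
coeff-+ (a ∷ p) []      k       = sym (ℤ.+-identityʳ _)
coeff-+ (a ∷ p) (b ∷ q) zero    = refl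
coeff-+ (a ∷ p) (b ∷ q) (suc k) = coeff-+ p q k

coeff-neg : ∀ p k → coeff (Poly.- p) k ≡ ℤ.- coeff p k
coeff-neg []      k       = refl
coeff-neg (a ∷ p) zero    = refl
coeff-neg (a ∷ p) (suc k) = coeff-neg p k

coeff-scale : ∀ a p k → coeff (map (a ℤ.*_) p) k ≡ a ℤ.* coeff p k
coeff-scale a []      k       = sym (ℤ.*-zeroʳ a)
coeff-scale a (b ∷ p) zero    = refl
coeff-scale a (b ∷ p) (suc k) = coeff-scale a p k

*-zeroʳ : ∀ p {q} → q Poly.≈ [] → p Poly.* q Poly.≈ []
*-zeroʳ []      q≈0 k = refl
*-zeroʳ (a ∷ p) {q} q≈0 k = begin
  coeff (map (a ℤ.*_) q Poly.+ (+ 0 ∷ p Poly.* q)) k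
    ≡⟨ coeff-+ (map (a ℤ.*_) q) _ k ⟩
  coeff (map (a ℤ.*_) q) k ℤ.+ coeff (+ 0 ∷ p Poly.* q) k
    ≡⟨ cong₂ ℤ._+_ (trans (coeff-scale a q k) (trans (cong (a ℤ.*_) (q≈0 k)) (ℤ.*-zeroʳ a)))
                   (shifted k) ⟩
  + 0 ∎
  where
  shifted : ∀ k → coeff (+ 0 ∷ p Poly.* q) k ≡ + 0
  shifted zero    = refl
  shifted (suc k) = *-zeroʳ p q≈0 k

-- Since `p Poly.≈ [ a ]` is coefficientwise, `p` may carry trailing zeros. Its tail then equals the
-- constant 0, so the induction applies to the tail with 0 in place of `a`.
coeff-constant-* : ∀ p a q → p Poly.≈ [ a ] → ∀ k → coeff (p Poly.* q) k ≡ a ℤ.* coeff q k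
-- The empty list agrees with `[ a ]` only if `a` is zero, which is the hypothesis at index 0.
coeff-constant-* []      a q p≈a k = trans (sym (ℤ.*-zeroˡ (coeff q k))) (cong (ℤ._* coeff q k) (p≈a 0))
coeff-constant-* (b ∷ p) a q p≈a k = begin
  coeff (map (b ℤ.*_) q Poly.+ (+ 0 ∷ p Poly.* q)) k
    ≡⟨ coeff-+ (map (b ℤ.*_) q) _ k ⟩
  coeff (map (b ℤ.*_) q) k ℤ.+ coeff (+ 0 ∷ p Poly.* q) k
    ≡⟨ cong₂ ℤ._+_ (trans (coeff-scale b q k) (cong (ℤ._* coeff q k) (p≈a 0))) (shifted k) ⟩
  a ℤ.* coeff q k ℤ.+ + 0
    ≡⟨ ℤ.+-identityʳ _ ⟩
  a ℤ.* coeff q k ∎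
  where
  shifted : ∀ k → coeff (+ 0 ∷ p Poly.* q) k ≡ + 0
  shifted zero    = refl
  shifted (suc k) = trans (coeff-constant-* p (+ 0) q p≈0 k) (ℤ.*-zeroˡ (coeff q k))
    where
    p≈0 : p Poly.≈ [ + 0 ]
    p≈0 zero    = p≈a 1
    p≈0 (suc j) = p≈a (suc (suc j))

*-zeroˡ : ∀ p q → p Poly.≈ [] → p Poly.* q Poly.≈ []
*-zeroˡ p q p≈0 k = trans (coeff-constant-* p (+ 0) q p≈[0] k) (ℤ.*-zeroˡ (coeff q k))
  where
  p≈[0] : p Poly.≈ [ + 0 ]
  p≈[0] zero    = p≈0 0
  p≈[0] (suc j) = p≈0 (suc j)

-- Finite sums of polynomials

polySum : List Poly.Carrier → Poly.Carrier
polySum = foldr Poly._+_ Poly.0#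

coeff-polySum-++ : ∀ ps qs k → coeff (polySum (ps ++ qs)) k ≡ coeff (polySum ps) k ℤ.+ coeff (polySum qs) k
coeff-polySum-++ []       qs k = sym (ℤ.+-identityˡ _)
coeff-polySum-++ (p ∷ ps) qs k = begin
  coeff (p Poly.+ polySum (ps ++ qs)) k
    ≡⟨ coeff-+ p _ k ⟩
  coeff p k ℤ.+ coeff (polySum (ps ++ qs)) k
    ≡⟨ cong (ℤ._+_ (coeff p k)) (coeff-polySum-++ ps qs k) ⟩
  coeff p k ℤ.+ (coeff (polySum ps) k ℤ.+ coeff (polySum qs) k)
    ≡⟨ ℤ.+-assoc (coeff p k) _ _ ⟨
  coeff p k ℤ.+ coeff (polySum ps) k ℤ.+ coeff (polySum qs) k
    ≡⟨ cong (ℤ._+ coeff (polySum qs) k) (coeff-+ p _ k) ⟨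
  coeff (p Poly.+ polySum ps) k ℤ.+ coeff (polySum qs) k ∎

polySum-zero : ∀ (f : ℕ → Poly.Carrier) n → (∀ i → f i Poly.≈ []) → polySum (applyUpTo f n) Poly.≈ []
polySum-zero f zero    f≈0 k = refl
polySum-zero f (suc n) f≈0 k =
  trans (coeff-+ (f 0) _ k) (cong₂ ℤ._+_ (f≈0 0 k) (polySum-zero (f ∘ suc) n (f≈0 ∘ suc) k))

polySum-truncate : ∀ (f : ℕ → Poly.Carrier) d n → (∀ i → d ≤ i → f i Poly.≈ []) →
                   polySum (applyUpTo f (d ℕ.+ n)) Poly.≈ polySum (applyUpTo f d)
polySum-truncate f zero    n f≈0 k = polySum-zero f n (λ i → f≈0 i z≤n) k
polySum-truncate f (suc d) n f≈0 k = begin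
  coeff (f 0 Poly.+ polySum (applyUpTo (f ∘ suc) (d ℕ.+ n))) k
    ≡⟨ coeff-+ (f 0) _ k ⟩
  coeff (f 0) k ℤ.+ coeff (polySum (applyUpTo (f ∘ suc) (d ℕ.+ n))) k
    ≡⟨ cong (ℤ._+_ (coeff (f 0) k)) (polySum-truncate (f ∘ suc) d n (λ i d≤i → f≈0 (suc i) (s≤s d≤i)) k) ⟩
  coeff (f 0) k ℤ.+ coeff (polySum (applyUpTo (f ∘ suc) d)) k
    ≡⟨ coeff-+ (f 0) _ k ⟨
  coeff (f 0 Poly.+ polySum (applyUpTo (f ∘ suc) d)) k ∎

-- Degree bounds in x and truncated Cauchy products

-- A record rather than a bare function type, so that `d` and `F` can be inferred from a proof of
-- the bound.
record Degree≤ (d : ℕ) (F : Carrier) : Set where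
  field vanishes : ∀ n → d < n → F n Poly.≈ []

open Degree≤

degree≤-weaken : ∀ {d e F} → d ≤ e → Degree≤ d F → Degree≤ e F
degree≤-weaken d≤e F≤ .vanishes n e<n = F≤ .vanishes n (ℕ.≤-<-trans d≤e e<n)

degree≤-0# : Degree≤ 0 0#
degree≤-0# .vanishes n _ k = refl

degree≤-1# : Degree≤ 0 1#
degree≤-1# .vanishes (suc n) _ k = refl

degree≤-x : Degree≤ 1 x
degree≤-x .vanishes (suc zero)    (s≤s ())
degree≤-x .vanishes (suc (suc n)) _ k = refl

degree≤-y : Degree≤ 0 y
degree≤-y .vanishes (suc n) _ k = refl

degree≤-+ : ∀ {d F G} → Degree≤ d F → Degree≤ d G → Degree≤ d (F + G)
degree≤-+ {F = F} F≤ G≤ .vanishes n d<n k =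
  trans (coeff-+ (F n) _ k) (cong₂ ℤ._+_ (F≤ .vanishes n d<n k) (G≤ .vanishes n d<n k))

degree≤-neg : ∀ {d F} → Degree≤ d F → Degree≤ d (- F)
degree≤-neg {F = F} F≤ .vanishes n d<n k =
  trans (coeff-neg (F n) k) (cong ℤ.-_ (F≤ .vanishes n d<n k))

degree≤-× : ∀ {d F} m → Degree≤ d F → Degree≤ d (m × F)
degree≤-× zero    F≤ = degree≤-weaken z≤n degree≤-0#
degree≤-× (suc m) F≤ = degree≤-+ F≤ (degree≤-× m F≤)

-- For `d ℕ.+ e < n`, each index `i` has either `d < i` or `e < n ∸ i`, so one factor of every term
-- is zero.
degree≤-* : ∀ {d e F G} → Degree≤ d F → Degree≤ e G → Degree≤ (d ℕ.+ e) (F * G)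
degree≤-* {d} {e} {F} {G} F≤ G≤ .vanishes n d+e<n =
  polySum-zero (λ i → F i Poly.* G (n ∸ i)) (suc n) term
  where
  term : ∀ i → F i Poly.* G (n ∸ i) Poly.≈ []
  term i with d ℕ.<? i
  ... | yes d<i = *-zeroˡ (F i) (G (n ∸ i)) (F≤ .vanishes i d<i)
  ... | no  d≮i = *-zeroʳ (F i) (G≤ .vanishes (n ∸ i) (ℕ.m+n≤o⇒m≤o∸n (suc e) e+i<n))
    where
    e+i<n : e ℕ.+ i < n
    e+i<n = ℕ.≤-<-trans (ℕ.+-monoʳ-≤ e (ℕ.≮⇒≥ d≮i)) (subst (_< n) (ℕ.+-comm d e) d+e<n)

degree≤-^ : ∀ {d F} m → Degree≤ d F → Degree≤ (m ℕ.* d) (F ^ m)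
degree≤-^ zero    F≤ = degree≤-1#
degree≤-^ (suc m) F≤ = degree≤-* F≤ (degree≤-^ m F≤)

-- Only the indices `i ≤ d` survive. Writing the exponent as `d ℕ.+ n` guarantees that all `suc d`
-- of them occur and gives the full sum the shape that `polySum-truncate` expects.
*-truncate : ∀ {d F} G n → Degree≤ d F →
             (F * G) (d ℕ.+ n) Poly.≈ polySum (applyUpTo (λ i → F i Poly.* G (d ℕ.+ n ∸ i)) (suc d))
*-truncate {d} {F} G n F≤ =
  polySum-truncate (λ i → F i Poly.* G (d ℕ.+ n ∸ i)) (suc d) n
    (λ i d<i → *-zeroˡ (F i) (G (d ℕ.+ n ∸ i)) (F≤ .vanishes i d<i))

degree≤-[1-x]³ : Degree≤ 3 ((1# - x) ^ 3)
degree≤-[1-x]³ = degree≤-^ 3 (degree≤-+ (degree≤-weaken z≤n degree≤-1#) (degree≤-neg degree≤-x))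

-- The weights 1, -3, 3, -1 are the coefficients of `(1# - x) ^ 3`, so multiplication by it takes
-- third differences. The final `+ 0` is the empty sum that ends the fold.
[1-x]³-* : ∀ G n k → coeff (((1# - x) ^ 3 * G) (3 ℕ.+ n)) k ≡
           + 1 ℤ.* coeff (G (3 ℕ.+ n)) k ℤ.+
           (-[1+ 2 ] ℤ.* coeff (G (2 ℕ.+ n)) k ℤ.+
           (+ 3 ℤ.* coeff (G (1 ℕ.+ n)) k ℤ.+ (-[1+ 0 ] ℤ.* coeff (G n) k ℤ.+ + 0)))
[1-x]³-* G n k = begin
  coeff ((P * G) (3 ℕ.+ n)) k
    ≡⟨ *-truncate G n degree≤-[1-x]³ k ⟩
  coeff (polySum (t₀ ∷ t₁ ∷ t₂ ∷ t₃ ∷ [])) k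
    ≡⟨ trans (coeff-+ t₀ _ k) (cong (ℤ._+_ (coeff t₀ k))
         (trans (coeff-+ t₁ _ k) (cong (ℤ._+_ (coeff t₁ k))
           (trans (coeff-+ t₂ _ k) (cong (ℤ._+_ (coeff t₂ k)) (coeff-+ t₃ _ k)))))) ⟩
  coeff t₀ k ℤ.+ (coeff t₁ k ℤ.+ (coeff t₂ k ℤ.+ (coeff t₃ k ℤ.+ + 0)))
    ≡⟨ cong₂ ℤ._+_ (coeff-constant-* (P 0) (+ 1) (G (3 ℕ.+ n)) P₀ k)
         (cong₂ ℤ._+_ (coeff-constant-* (P 1) -[1+ 2 ] (G (2 ℕ.+ n)) P₁ k)
           (cong₂ ℤ._+_ (coeff-constant-* (P 2) (+ 3) (G (1 ℕ.+ n)) P₂ k)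
             (cong (ℤ._+ + 0) (coeff-constant-* (P 3) -[1+ 0 ] (G n) P₃ k)))) ⟩
  _ ∎
  where
  P : Carrier
  P = (1# - x) ^ 3

  t₀ t₁ t₂ t₃ : Poly.Carrier
  t₀ = P 0 Poly.* G (3 ℕ.+ n)
  t₁ = P 1 Poly.* G (2 ℕ.+ n)
  t₂ = P 2 Poly.* G (1 ℕ.+ n)
  t₃ = P 3 Poly.* G n

  P₀ : P 0 Poly.≈ [ + 1 ]
  P₀ zero          = refl
  P₀ (suc zero)    = refl
  P₀ (suc (suc j)) = refl

  P₁ : P 1 Poly.≈ [ -[1+ 2 ] ]
  P₁ zero          = refl
  P₁ (suc zero)    = refl
  P₁ (suc (suc j)) = refl

  P₂ : P 2 Poly.≈ [ + 3 ]
  P₂ zero          = refl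
  P₂ (suc zero)    = refl
  P₂ (suc (suc j)) = refl

  P₃ : P 3 Poly.≈ [ -[1+ 0 ] ]
  P₃ zero          = refl
  P₃ (suc zero)    = refl
  P₃ (suc (suc j)) = refl

-- Admissible words and their descent polynomials

Admissible : Pred Word _
Admissible = Avoids ℕ._≥_ _≢_

admissible? : Decidable Admissible
admissible? = avoids? _≥?_ _≢?_

-- Filtering happens inside, so that `C _≥?_ _≢?_ n` unfolds to `desPoly (catalanWords n)` and an
-- enumeration can be split before it is filtered.
desPoly : List Word → Poly.Carrier
desPoly ws = polySum (map (λ w → yPoly ^ᵖ des w) (filter admissible? ws))

coeff-desPoly-++ : ∀ vs ws k → coeff (desPoly (vs ++ ws)) k ≡ coeff (desPoly vs) k ℤ.+ coeff (desPoly ws) k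
coeff-desPoly-++ vs ws k
  rewrite filter-++ admissible? vs ws
        | map-++ (λ w → yPoly ^ᵖ des w) (filter admissible? vs) (filter admissible? ws)
  = coeff-polySum-++ (map _ (filter admissible? vs)) _ k

admissible-tail : ∀ {a w} → Admissible (a ∷ w) → Admissible w
admissible-tail av = av ∘ there

admissible-ascent : ∀ {a b w} → a < b → Admissible (b ∷ w) → Admissible (a ∷ b ∷ w)
admissible-ascent a<b av (here a≥b _) = ℕ.<⇒≱ a<b a≥b
admissible-ascent a<b av (there c)    = av c

des-ascent : ∀ {a b} w → a < b → des (a ∷ b ∷ w) ≡ des (b ∷ w)
des-ascent {a} {b} w a<b rewrite dec-false (b ℕ.<? a) (ℕ.<⇒≯ a<b) = refl

desPoly-accept : ∀ {w} ws → Admissible w → desPoly (w ∷ ws) ≡ yPoly ^ᵖ des w Poly.+ desPoly ws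
desPoly-accept ws av = cong (λ vs → polySum (map (λ w → yPoly ^ᵖ des w) vs)) (filter-accept admissible? av)

desPoly-reject : ∀ {w} ws → ¬ Admissible w → desPoly (w ∷ ws) ≡ desPoly ws
desPoly-reject ws ¬av = cong (λ vs → polySum (map (λ w → yPoly ^ᵖ des w) vs)) (filter-reject admissible? ¬av)

-- An initial ascent can neither begin an occurrence of the pattern nor add a descent, so removing
-- `a` preserves both admissibility and weight.
desPoly-ascent : ∀ {a b} → a < b → ∀ ws →
                 desPoly (map (a ∷_) (map (b ∷_) ws)) ≡ desPoly (map (b ∷_) ws)
desPoly-ascent a<b [] = refl
desPoly-ascent {a} {b} a<b (w ∷ ws) with admissible? (b ∷ w)
... | yes av = begin
  desPoly ((a ∷ b ∷ w) ∷ map (a ∷_) (map (b ∷_) ws))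
    ≡⟨ desPoly-accept _ (admissible-ascent a<b av) ⟩
  yPoly ^ᵖ des (a ∷ b ∷ w) Poly.+ desPoly (map (a ∷_) (map (b ∷_) ws))
    ≡⟨ cong₂ (λ d p → yPoly ^ᵖ d Poly.+ p) (des-ascent w a<b) (desPoly-ascent a<b ws) ⟩
  yPoly ^ᵖ des (b ∷ w) Poly.+ desPoly (map (b ∷_) ws)
    ≡⟨ desPoly-accept _ av ⟨
  desPoly ((b ∷ w) ∷ map (b ∷_) ws) ∎
... | no ¬av = begin
  desPoly ((a ∷ b ∷ w) ∷ map (a ∷_) (map (b ∷_) ws))
    ≡⟨ desPoly-reject _ (¬av ∘ admissible-tail {a}) ⟩
  desPoly (map (a ∷_) (map (b ∷_) ws))
    ≡⟨ desPoly-ascent a<b ws ⟩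
  desPoly (map (b ∷_) ws)
    ≡⟨ desPoly-reject _ ¬av ⟨
  desPoly ((b ∷ w) ∷ map (b ∷_) ws) ∎

-- Words that begin with a weak descent

replicate-linked : ∀ b m → Linked Step (b ∷ replicate m b)
replicate-linked b zero    = [-]
replicate-linked b (suc m) = ℕ.n≤1+n b ∷ replicate-linked b m

-- The second relation of any occurrence would have to hold between `b` and itself.
replicate-admissible : ∀ a b m → Admissible (a ∷ b ∷ replicate m b)
replicate-admissible a b zero    (there (there ()))
replicate-admissible a b (suc m) (here _ b≢b) = b≢b refl
replicate-admissible a b (suc m) (there c)    = replicate-admissible b b m c

-- Avoidance forces the letter after `b` to equal `b`. That equality is again a weak descent, so the
-- argument repeats.
admissible-plateau : ∀ {a b} w → b ≤ a → Admissible (a ∷ b ∷ w) → w ≡ replicate (length w) b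
admissible-plateau []      b≤a av = refl
admissible-plateau {b = b} (c ∷ w) b≤a av with b ℕ.≟ c
... | yes refl = cong (b ∷_) (admissible-plateau w ℕ.≤-refl (admissible-tail av))
... | no  b≢c  = contradiction (here b≤a b≢c) av

-- Turns a description of the members of a filtered enumeration into the list itself, so that the
-- filter need not be evaluated.
unique-singleton : ∀ {A : Set} {z : A} {zs} → Unique zs → z ∈ zs → (∀ {u} → u ∈ zs → u ≡ z) → zs ≡ [ z ]
unique-singleton {zs = u ∷ []}     _                 _ all = cong [_] (all (here refl))
unique-singleton {zs = u ∷ v ∷ zs} ((u≢v ∷ _) ∷ _) _ all =
  contradiction (trans (all (here refl)) (sym (all (there (here refl))))) u≢v

-- The enumeration has no repetitions, contains the constant run by completeness, and by
-- `admissible-plateau` has no other admissible member; soundness fixes the length of the run.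
filter-plateau : ∀ {a b} m → b ≤ a →
                 filter admissible? (map (a ∷_) (map (b ∷_) (continuations b m))) ≡ [ a ∷ b ∷ replicate m b ]
filter-plateau {a} {b} m b≤a = unique-singleton
  (Unique.filter⁺ admissible? (Unique.map⁺ ∷-injectiveʳ (Unique.map⁺ ∷-injectiveʳ (continuations-unique b m))))
  (∈-filter⁺ admissible? (∈-map⁺ (a ∷_) (∈-map⁺ (b ∷_) replicate∈)) (replicate-admissible a b m))
  only
  where
  replicate∈ : replicate m b ∈ continuations b m
  replicate∈ = subst (λ l → replicate m b ∈ continuations b l) (length-replicate m)
                     (continuations-complete b (replicate m b) (replicate-linked b m))

  only : ∀ {u} → u ∈ filter admissible? (map (a ∷_) (map (b ∷_) (continuations b m))) →
         u ≡ a ∷ b ∷ replicate m b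
  only u∈
    with u∈′ , av ← ∈-filter⁻ admissible? {xs = map (a ∷_) (map (b ∷_) (continuations b m))} u∈
    with _ , v∈ , refl ← ∈-map⁻ (a ∷_) u∈′
    with w , w∈ , refl ← ∈-map⁻ (b ∷_) v∈
    = cong (λ v → a ∷ b ∷ v)
           (trans (admissible-plateau w b≤a av)
                  (cong (λ l → replicate l b) (proj₂ (continuations-sound b m w∈))))

-- Counting admissible continuations by descents

des-replicate : ∀ b m → des (b ∷ replicate m b) ≡ 0
des-replicate b zero    = refl
des-replicate b (suc m) rewrite dec-false (b ℕ.<? b) (ℕ.<-irrefl refl) = des-replicate b m

-- The polynomial p + q y. Degree 1 suffices because an admissible word is constant after its first
-- descent.
linear : ℕ → ℕ → Poly.Carrier
linear p q = + p ∷ + q ∷ []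

coeff-linear-+ : ∀ p q r s k → coeff (linear p q) k ℤ.+ coeff (linear r s) k ≡ coeff (linear (p ℕ.+ r) (q ℕ.+ s)) k
coeff-linear-+ p q r s zero          = refl
coeff-linear-+ p q r s (suc zero)    = refl
coeff-linear-+ p q r s (suc (suc k)) = refl

desPoly-descent : ∀ {a b} m → b < a →
                  desPoly (map (a ∷_) (map (b ∷_) (continuations b m))) Poly.≈ linear 0 1
desPoly-descent {a} {b} m b<a k
  rewrite filter-plateau m (ℕ.<⇒≤ b<a) | dec-true (b ℕ.<? a) b<a | des-replicate b m = evaluate k
  where
  evaluate : polySum [ yPoly ^ᵖ 1 ] Poly.≈ linear 0 1
  evaluate zero          = refl
  evaluate (suc zero)    = refl
  evaluate (suc (suc k)) = refl

desPoly-level : ∀ a m → desPoly (map (a ∷_) (map (a ∷_) (continuations a m))) Poly.≈ linear 1 0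
desPoly-level a m k
  -- The surviving word is a constant run of `a` including its first letter, hence `suc m`.
  rewrite filter-plateau m (ℕ.≤-refl {a}) | des-replicate a (suc m) = evaluate k
  where
  evaluate : polySum [ yPoly ^ᵖ 0 ] Poly.≈ linear 1 0
  evaluate zero          = refl
  evaluate (suc zero)    = refl
  evaluate (suc (suc k)) = refl

-- Splits off the largest next letter. The letters `suc a` and `a` behave differently from the
-- smaller ones, and they stand at the end of `upTo (2 ℕ.+ a)`.
coeff-desPoly-upTo-suc : ∀ a (f : ℕ → List Word) j k →
  coeff (desPoly (map (a ∷_) (concatMap f (upTo (suc j))))) k ≡
  coeff (desPoly (map (a ∷_) (concatMap f (upTo j)))) k ℤ.+ coeff (desPoly (map (a ∷_) (f j))) k
coeff-desPoly-upTo-suc a f j k = begin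
  coeff (desPoly (map (a ∷_) (concatMap f (upTo (suc j))))) k
    ≡⟨ cong (λ ws → coeff (desPoly ws) k) split ⟩
  coeff (desPoly (map (a ∷_) (concatMap f (upTo j)) ++ map (a ∷_) (f j))) k
    ≡⟨ coeff-desPoly-++ (map (a ∷_) (concatMap f (upTo j))) _ k ⟩
  coeff (desPoly (map (a ∷_) (concatMap f (upTo j)))) k ℤ.+ coeff (desPoly (map (a ∷_) (f j))) k ∎
  where
  split : map (a ∷_) (concatMap f (upTo (suc j))) ≡ map (a ∷_) (concatMap f (upTo j)) ++ map (a ∷_) (f j)
  split = begin
    map (a ∷_) (concatMap f (upTo (suc j)))
      ≡⟨ cong (map (a ∷_) ∘ concatMap f) (upTo-∷ʳ j) ⟨
    map (a ∷_) (concatMap f (upTo j ++ [ j ]))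
      ≡⟨ cong (map (a ∷_)) (concatMap-++ f (upTo j) [ j ]) ⟩
    map (a ∷_) (concatMap f (upTo j) ++ (f j ++ []))
      ≡⟨ cong (λ ws → map (a ∷_) (concatMap f (upTo j) ++ ws)) (++-identityʳ (f j)) ⟩
    map (a ∷_) (concatMap f (upTo j) ++ f j)
      ≡⟨ map-++ (a ∷_) (concatMap f (upTo j)) (f j) ⟩
    map (a ∷_) (concatMap f (upTo j)) ++ map (a ∷_) (f j) ∎

choose-2-suc : ∀ n → suc n choose 2 ≡ n ℕ.+ n choose 2
choose-2-suc n = trans (sym (nCk+nC[k+1]≡[n+1]C[k+1] n 1)) (cong (ℕ._+ n choose 2) (nC1≡n n))

-- Split by the next letter: `suc a` continues the climb and is handled by induction, `a` gives one
-- word without descent, and each of the `a` smaller letters gives one word with one descent.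
-- Unrolled, a drop after i ascents has a + i targets, and the sum of a + i over i < m is a m + (m
-- choose 2).
desPoly-continuations : ∀ a m →
  desPoly (map (a ∷_) (continuations a m)) Poly.≈ linear (suc m) (a ℕ.* m ℕ.+ m choose 2)
desPoly-continuations a zero    k rewrite ℕ.*-zeroʳ a = evaluate k
  where
  evaluate : polySum [ yPoly ^ᵖ 0 ] Poly.≈ linear 1 0
  evaluate zero          = refl
  evaluate (suc zero)    = refl
  evaluate (suc (suc k)) = refl
desPoly-continuations a (suc m) k = begin
  coeff (desPoly (map (a ∷_) (concatMap next (upTo (2 ℕ.+ a))))) k
    ≡⟨ coeff-desPoly-upTo-suc a next (suc a) k ⟩
  coeff (desPoly (map (a ∷_) (concatMap next (upTo (1 ℕ.+ a))))) k ℤ.+ coeff (desPoly (map (a ∷_) (next (suc a)))) k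
    ≡⟨ cong₂ ℤ._+_ (coeff-desPoly-upTo-suc a next a k)
         (trans (cong (λ p → coeff p k) (desPoly-ascent (ℕ.n<1+n a) (continuations (suc a) m)))
                (desPoly-continuations (suc a) m k)) ⟩
  coeff (desPoly (map (a ∷_) (concatMap next (upTo a)))) k ℤ.+ coeff (desPoly (map (a ∷_) (next a))) k
    ℤ.+ coeff (linear (suc m) c) k
    ≡⟨ cong (ℤ._+ coeff (linear (suc m) c) k) (cong₂ ℤ._+_ (descents a ℕ.≤-refl k) (desPoly-level a m k)) ⟩
  coeff (linear 0 a) k ℤ.+ coeff (linear 1 0) k ℤ.+ coeff (linear (suc m) c) k
    ≡⟨ cong (ℤ._+ coeff (linear (suc m) c) k) (coeff-linear-+ 0 a 1 0 k) ⟩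
  coeff (linear 1 (a ℕ.+ 0)) k ℤ.+ coeff (linear (suc m) c) k
    ≡⟨ coeff-linear-+ 1 (a ℕ.+ 0) (suc m) c k ⟩
  coeff (linear (2 ℕ.+ m) (a ℕ.+ 0 ℕ.+ c)) k
    ≡⟨ cong (λ q → coeff (linear (2 ℕ.+ m) q) k) count ⟩
  coeff (linear (2 ℕ.+ m) (a ℕ.* suc m ℕ.+ suc m choose 2)) k ∎
  where
  next : ℕ → List Word
  next b = map (b ∷_) (continuations b m)

  c : ℕ
  c = suc a ℕ.* m ℕ.+ m choose 2

  -- Induction needs a bound `j` separate from `a`, while `j ≤ a` keeps every letter counted
  -- strictly below `a`.
  descents : ∀ j → j ≤ a → desPoly (map (a ∷_) (concatMap next (upTo j))) Poly.≈ linear 0 j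
  descents zero    _   zero          = refl
  descents zero    _   (suc zero)    = refl
  descents zero    _   (suc (suc _)) = refl
  descents (suc j) j<a k = begin
    coeff (desPoly (map (a ∷_) (concatMap next (upTo (suc j))))) k
      ≡⟨ coeff-desPoly-upTo-suc a next j k ⟩
    coeff (desPoly (map (a ∷_) (concatMap next (upTo j)))) k ℤ.+ coeff (desPoly (map (a ∷_) (next j))) k
      ≡⟨ cong₂ ℤ._+_ (descents j (ℕ.<⇒≤ j<a) k) (desPoly-descent m j<a k) ⟩
    coeff (linear 0 j) k ℤ.+ coeff (linear 0 1) k
      ≡⟨ coeff-linear-+ 0 j 0 1 k ⟩
    coeff (linear 0 (j ℕ.+ 1)) k
      ≡⟨ cong (λ q → coeff (linear 0 q) k) (ℕ.+-comm j 1) ⟩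
    coeff (linear 0 (suc j)) k ∎

  count : a ℕ.+ 0 ℕ.+ c ≡ a ℕ.* suc m ℕ.+ suc m choose 2
  count = begin
    a ℕ.+ 0 ℕ.+ (m ℕ.+ a ℕ.* m ℕ.+ m choose 2)
      ≡⟨ rearrange a m (m choose 2) ⟩
    a ℕ.* suc m ℕ.+ (m ℕ.+ m choose 2)
      ≡⟨ cong (a ℕ.* suc m ℕ.+_) (choose-2-suc m) ⟨
    a ℕ.* suc m ℕ.+ suc m choose 2 ∎
    where
    rearrange : ∀ a m t → a ℕ.+ 0 ℕ.+ (m ℕ.+ a ℕ.* m ℕ.+ t) ≡ a ℕ.* suc m ℕ.+ (m ℕ.+ t)
    rearrange = ℕ-Solver.solve-∀

-- A nonempty Catalan word starts with 0, so `a` is 0 and the term `a ℕ.* m` vanishes by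
-- computation.
C-suc : ∀ m → C _≥?_ _≢?_ (suc m) Poly.≈ linear (suc m) (m choose 2)
C-suc m = desPoly-continuations 0 m

-- Third differences and comparison of coefficients

-- The constant coefficients are linear in `n` and those of y are quadratic, so third differences
-- annihilate both.
thirdDifference-linear : ∀ n k →
  + 1 ℤ.* coeff (linear (4 ℕ.+ n) ((3 ℕ.+ n) choose 2)) k ℤ.+
  (-[1+ 2 ] ℤ.* coeff (linear (3 ℕ.+ n) ((2 ℕ.+ n) choose 2)) k ℤ.+
  (+ 3 ℤ.* coeff (linear (2 ℕ.+ n) ((1 ℕ.+ n) choose 2)) k ℤ.+
  (-[1+ 0 ] ℤ.* coeff (linear (1 ℕ.+ n) (n choose 2)) k ℤ.+ + 0))) ≡ + 0
thirdDifference-linear n zero = identity (+ n)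
  where
  identity : ∀ a → + 1 ℤ.* (+ 4 ℤ.+ a) ℤ.+ (-[1+ 2 ] ℤ.* (+ 3 ℤ.+ a) ℤ.+
             (+ 3 ℤ.* (+ 2 ℤ.+ a) ℤ.+ (-[1+ 0 ] ℤ.* (+ 1 ℤ.+ a) ℤ.+ + 0))) ≡ + 0
  identity = solve-∀
thirdDifference-linear n (suc zero)
  -- Expressing all four binomials through `n choose 2` leaves a ring identity in which `n` and
  -- `n choose 2` are independent variables.
  rewrite choose-2-suc (2 ℕ.+ n) | choose-2-suc (1 ℕ.+ n) | choose-2-suc n = identity (+ n) (+ (n choose 2))
  where
  identity : ∀ a t →
    + 1 ℤ.* (+ 2 ℤ.+ a ℤ.+ (+ 1 ℤ.+ a ℤ.+ (a ℤ.+ t))) ℤ.+ (-[1+ 2 ] ℤ.* (+ 1 ℤ.+ a ℤ.+ (a ℤ.+ t)) ℤ.+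
    (+ 3 ℤ.* (a ℤ.+ t) ℤ.+ (-[1+ 0 ] ℤ.* t ℤ.+ + 0))) ≡ + 0
  identity = solve-∀
thirdDifference-linear n (suc (suc k)) = refl

numerator : Carrier
numerator = 1# - 2 × x + 2 × x ^ 2 - x ^ 3 + x ^ 3 * y

-- Supplies the zeros on the right beyond x³, where the Cauchy products do not evaluate at a
-- variable exponent.
degree≤-numerator : Degree≤ 3 numerator
degree≤-numerator =
  degree≤-+ (degree≤-+ (degree≤-+ (degree≤-+
    (degree≤-weaken z≤n degree≤-1#)
    (degree≤-neg (degree≤-weaken (s≤s z≤n) (degree≤-× 2 degree≤-x))))
    (degree≤-weaken (s≤s (s≤s z≤n)) (degree≤-× 2 (degree≤-^ 2 degree≤-x))))
    (degree≤-neg (degree≤-^ 3 degree≤-x)))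
    (degree≤-* (degree≤-^ 3 degree≤-x) degree≤-y)

theorem3p26 : (1# - x) ^ 3 * C _≥?_ _≢?_ ≈ 1# - 2 × x + 2 × x ^ 2 - x ^ 3 + x ^ 3 * y
-- Exponents up to 3 are computed directly: their differences involve the empty word, whose
-- coefficient 1 does not follow the formula in `C-suc`.
theorem3p26 0 k = refl
theorem3p26 1 zero = refl
theorem3p26 1 (suc zero) = refl
theorem3p26 1 (suc (suc k)) = refl
theorem3p26 2 zero = refl
theorem3p26 2 (suc zero) = refl
theorem3p26 2 (suc (suc k)) = refl
theorem3p26 3 k = refl
-- From exponent 4 on, the four lengths involved are all positive, so `C-suc` covers each of them.
theorem3p26 (suc (suc (suc (suc n)))) k = begin
  coeff (((1# - x) ^ 3 * C _≥?_ _≢?_) (4 ℕ.+ n)) k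
    ≡⟨ [1-x]³-* (C _≥?_ _≢?_) (suc n) k ⟩
  _
    ≡⟨ cong₂ (λ s t → + 1 ℤ.* s ℤ.+ t) (C-suc (3 ℕ.+ n) k)
         (cong₂ (λ s t → -[1+ 2 ] ℤ.* s ℤ.+ t) (C-suc (2 ℕ.+ n) k)
           (cong₂ (λ s t → + 3 ℤ.* s ℤ.+ (-[1+ 0 ] ℤ.* t ℤ.+ + 0)) (C-suc (1 ℕ.+ n) k) (C-suc n k))) ⟩
  _
    ≡⟨ thirdDifference-linear n k ⟩
  + 0
    ≡⟨ degree≤-numerator .vanishes (4 ℕ.+ n) (s≤s (s≤s (s≤s (s≤s z≤n)))) k ⟨
  coeff (numerator (4 ℕ.+ n)) k ∎
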